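{- The only positive integers $n$ of the form $n=2^{\alpha}5^{\beta}$, with integers $\alpha,\beta\geq 0$, that satisfy the congruence $$n\varphi(n)\equiv 2\pmod{\sigma(n)}$$ are $n=1,2,5,8$.
   Context: For a positive integer $n$, $\varphi(n)$ denotes the Euler totient function of $n$ and $\sigma(n)$ denotes the sum of the positive divisors of $n$. -}

module Defs where

open import Data.Integer.Base using (+_; _-_)
open import Data.Integer.Divisibility using (_∣_)
open import Data.List.Base using (List; applyUpTo; filter; length)
open import Data.Nat.Base using (ℕ; suc)
open import Data.Nat.Coprimality using (coprime?)
open import Data.Nat.Divisibility using (_∣?_)
open import Data.Nat.ListAction using (sum)

[1⋯_] : ℕ → List ℕ
[1⋯ n ] = applyUpTo suc n

φ : ℕ → ℕ
φ n = length (filter (λ k → coprime? k n) [1⋯ n ])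

σ : ℕ → ℕ
σ n = sum (filter (λ d → d ∣? n) [1⋯ n ])

-- The difference is taken in ℤ, since a may be smaller than b
-- (n * φ n = 1 when n = 1).
infix 4 _≡_[mod_]

_≡_[mod_] : ℕ → ℕ → ℕ → Set
a ≡ b [mod m ] = + m ∣ + a - + b

{-# OPTIONS --safe #-}

-- Let n = 2^α 5^β, M = 2^(α+1) - 1 and S = (5^(β+1) - 1)/4, so that σ n = M S.
-- If β = 0 the congruence gives M ∣ 15, and if α = 0 it gives S ∣ 246.
-- If α, β ≥ 1, reduction modulo 3 shows that α and β are even; then u = M and
-- v = 4 S satisfy u v ∣ u² + v² + 2u + 2v - 499.  Vieta jumping reduces the
-- quotient c of this divisibility to that of a solution with u ≤ 21, which
-- leaves twelve values of c, and each of them is impossible modulo 504 because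
-- u + 1 is a power of 2 and v + 1 a power of 5.
module Submission where

open import Defs
open import Data.Nat.Base using (ℕ; _*_; _^_; _≥_)
open import Data.Product.Base using (_×_; ∃-syntax)
open import Data.Sum.Base using (_⊎_)
open import Function.Bundles using (_⇔_)
open import Relation.Binary.PropositionalEquality.Core using (_≡_)

open import Data.Empty using (⊥)
import Data.Integer.Base as ℤ
import Data.Integer.Properties as ℤ
open import Data.List.Base using (List; []; _∷_; _++_; applyUpTo; filter; length; map)
open import Data.List.Membership.DecPropositional using (_∈?_)
open import Data.List.Membership.Propositional using (_∈_)
open import Data.List.Membership.Propositional.Properties
  using (∈-filter⁺; ∈-filter⁻; ∈-applyUpTo⁺; ∈-++⁺ˡ; ∈-++⁺ʳ; ∈-++⁻; ∈-map⁺; ∈-map⁻)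
open import Data.List.Properties using (filter-++; filter-≐; length-++)
open import Data.List.Membership.Propositional.Properties.WithK using (unique∧set⇒bag)
open import Data.List.Relation.Binary.BagAndSetEquality using (∼bag⇒↭)
open import Data.List.Relation.Unary.All as All using (All; all?)
open import Data.List.Relation.Unary.Any using (here)
open import Data.List.Relation.Unary.Unique.Propositional using (Unique)
import Data.List.Relation.Unary.Unique.Propositional.Properties as Unique
open import Data.Nat.Base hiding (_*_; _^_; _≥_)
open import Data.Nat.Coprimality using (Coprime; coprime?; coprime-+; coprime-divisor)
open import Data.Nat.Divisibility
open import Data.Nat.DivMod
open import Data.Nat.Induction using (<-rec)
open import Data.Nat.ListAction using (sum)
open import Data.Nat.ListAction.Properties using (sum-++; sum-↭)
open import Data.Nat.Primality using (Prime; prime?; euclidsLemma; prime[2]; prime⇒nonZero)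
open import Data.Nat.Properties
open import Data.Nat.Tactic.RingSolver using (solve-∀)
open import Data.Product.Base using (_,_; proj₁; proj₂)
open import Data.Sum.Base using (inj₁; inj₂; [_,_]′; fromInj₁)
open import Function.Base using (_∘_; flip)
open import Function.Bundles using (mk⇔; module Equivalence)
open import Level using (Level)
open import Relation.Binary.PropositionalEquality
  using (refl; sym; trans; cong; cong₂; subst; _≢_; module ≡-Reasoning)
open import Relation.Nullary using (¬_; Dec; yes; no; contradiction)
open import Relation.Nullary.Decidable using (from-yes; from-no; _→-dec_; ¬?)
open import Relation.Unary using (Pred; Decidable)

private
  variable
    ℓ : Level
    A : Set ℓ
    m n p : ℕ

-- Euler's totient

applyUpTo-+ : (f : ℕ → A) → ∀ m n →
  applyUpTo f (m + n) ≡ applyUpTo f m ++ applyUpTo (f ∘ (m +_)) n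
applyUpTo-+ f zero    n = refl
applyUpTo-+ f (suc m) n = cong (f 0 ∷_) (applyUpTo-+ (f ∘ suc) m n)

length-filter-applyUpTo-cong : {P : Pred A ℓ} (P? : Decidable P) {f g : ℕ → A} →
  (∀ i → P (f i) ⇔ P (g i)) → ∀ n →
  length (filter P? (applyUpTo f n)) ≡ length (filter P? (applyUpTo g n))
length-filter-applyUpTo-cong P? f⇔g zero = refl
length-filter-applyUpTo-cong P? {f} {g} f⇔g (suc n) with P? (f 0) | P? (g 0)
... | yes _ | yes _ = cong suc (length-filter-applyUpTo-cong P? (f⇔g ∘ suc) n)
... | no  _ | no  _ = length-filter-applyUpTo-cong P? (f⇔g ∘ suc) n
... | yes x | no ¬y = contradiction (Equivalence.to (f⇔g 0) x) ¬y
... | no ¬x | yes y = contradiction (Equivalence.from (f⇔g 0) y) ¬x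

count-periodic : {P : Pred ℕ ℓ} (P? : Decidable P) → ∀ n → (∀ i → P (n + i) ⇔ P i) → ∀ k →
  length (filter P? [1⋯ k * n ]) ≡ k * length (filter P? [1⋯ n ])
count-periodic P? n per zero    = refl
count-periodic {P = P} P? n per (suc k) = begin
  length (filter P? [1⋯ n + k * n ])
    ≡⟨ cong (length ∘ filter P?) (applyUpTo-+ suc n (k * n)) ⟩
  length (filter P? ([1⋯ n ] ++ shifted))
    ≡⟨ cong length (filter-++ P? [1⋯ n ] shifted) ⟩
  length (filter P? [1⋯ n ] ++ filter P? shifted)
    ≡⟨ length-++ (filter P? [1⋯ n ]) ⟩
  length (filter P? [1⋯ n ]) + length (filter P? shifted)
    ≡⟨ cong (length (filter P? [1⋯ n ]) +_) (length-filter-applyUpTo-cong P? per′ (k * n)) ⟩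
  length (filter P? [1⋯ n ]) + length (filter P? [1⋯ k * n ])
    ≡⟨ cong (length (filter P? [1⋯ n ]) +_) (count-periodic P? n per k) ⟩
  suc k * length (filter P? [1⋯ n ]) ∎
  where
  open ≡-Reasoning
  shifted = applyUpTo (suc ∘ (n +_)) (k * n)
  per′ : ∀ i → P (suc (n + i)) ⇔ P (suc i)
  per′ i = subst (λ x → P x ⇔ P (suc i)) (+-suc n i) (per (suc i))

-- Since `p` already divides `n`, coprimality to `p * n` and to `n` are the same condition. That
-- condition has period `n`, and the range up to `p * n` consists of `p` periods.
φ-step : p ∣ n → φ (p * n) ≡ p * φ n
φ-step {p} {n} p∣n = begin
  φ (p * n)
    ≡⟨ cong length (filter-≐ (λ k → coprime? k (p * n)) (λ k → coprime? k n) (restrict , extend) [1⋯ p * n ]) ⟩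
  length (filter (λ k → coprime? k n) [1⋯ p * n ])
    ≡⟨ count-periodic (λ k → coprime? k n) n (λ _ → mk⇔ coprime-+⁻ coprime-+) p ⟩
  p * φ n ∎
  where
  open ≡-Reasoning
  restrict : ∀ {k} → Coprime k (p * n) → Coprime k n
  restrict c (d∣k , d∣n) = c (d∣k , ∣n⇒∣m*n p d∣n)
  extend : ∀ {k} → Coprime k n → Coprime k (p * n)
  extend c {d} (d∣k , d∣pn) = c (d∣k , ∣-trans d∣p p∣n)
    where d∣p = coprime-divisor (λ (e∣d , e∣n) → c (∣-trans e∣d d∣k , e∣n)) (subst (d ∣_) (*-comm p n) d∣pn)
  coprime-+⁻ : ∀ {k} → Coprime (n + k) n → Coprime k n
  coprime-+⁻ c (d∣k , d∣n) = c (∣m∣n⇒∣m+n d∣n d∣k , d∣n)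

φ-power : p ∣ n → ∀ k → φ (p ^ k * n) ≡ p ^ k * φ n
φ-power {p} {n} p∣n zero    = trans (cong φ (*-identityˡ n)) (sym (*-identityˡ (φ n)))
φ-power {p} {n} p∣n (suc k) = begin
  φ (p * p ^ k * n)   ≡⟨ cong φ (*-assoc p (p ^ k) n) ⟩
  φ (p * (p ^ k * n)) ≡⟨ φ-step (∣n⇒∣m*n (p ^ k) p∣n) ⟩
  p * φ (p ^ k * n)   ≡⟨ cong (p *_) (φ-power p∣n k) ⟩
  p * (p ^ k * φ n)   ≡⟨ *-assoc p (p ^ k) (φ n) ⟨
  p * p ^ k * φ n     ∎
  where open ≡-Reasoning

-- The sum of divisors

divisors : ℕ → List ℕ
divisors n = filter (_∣? n) [1⋯ n ]

∈-divisors⁺ : ∀ {d} .{{_ : NonZero n}} → d ∣ n → d ∈ divisors n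
∈-divisors⁺ {n} {zero}  0∣n = contradiction (0∣⇒≡0 0∣n) (≢-nonZero⁻¹ n)
∈-divisors⁺ {n} {suc d} d∣n = ∈-filter⁺ (_∣? n) (∈-applyUpTo⁺ suc (∣⇒≤ d∣n)) d∣n

∈-divisors⁻ : ∀ {d} → d ∈ divisors n → d ∣ n
∈-divisors⁻ {n} = proj₂ ∘ ∈-filter⁻ (_∣? n) {xs = [1⋯ n ]}

divisors-unique : ∀ n → Unique (divisors n)
divisors-unique n = Unique.filter⁺ (_∣? n)
  (Unique.applyUpTo⁺₁ suc n (λ i<j _ → <⇒≢ i<j ∘ suc-injective))

-- Euclid's lemma moves one factor `p` at a time into `d`, because `q` can absorb none.
prime-power-divisor : Prime p → ∀ k {d q} → ¬ p ∣ q → p ^ k ∣ d * q → p ^ k ∣ d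
prime-power-divisor pp zero    p∤q _ = 1∣ _
prime-power-divisor {p} pp (suc k) {d} {q} p∤q pᵏ∣dq
  with euclidsLemma d q pp (∣-trans (m∣m*n (p ^ k)) pᵏ∣dq)
... | inj₂ p∣q = contradiction p∣q p∤q
... | inj₁ (divides-refl e) = subst (_∣ e * p) (*-comm (p ^ k) p)
  (*-monoˡ-∣ p (prime-power-divisor pp k {e} {q} p∤q (*-cancelˡ-∣ p (subst (p * p ^ k ∣_) (lemma e p q) pᵏ∣dq))))
  where
  instance _ = prime⇒nonZero pp
  lemma : ∀ e p q → e * p * q ≡ p * (e * q)
  lemma = solve-∀

sum-map-* : ∀ c xs → sum (map (c *_) xs) ≡ c * sum xs
sum-map-* c []       = sym (*-zeroʳ c)
sum-map-* c (x ∷ xs) = trans (cong (c * x +_) (sum-map-* c xs)) (sym (*-distribˡ-+ c x (sum xs)))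

-- The divisors of p^(k+1) m are those of p^k m together with the numbers p^(k+1) e for e dividing
-- m. Both lists are duplicate-free and they are disjoint, so equality as sets gives a permutation
-- and hence equal sums.
σ-step : Prime p → .{{_ : NonZero m}} → ¬ p ∣ m → ∀ k →
  σ (p ^ suc k * m) ≡ σ (p ^ k * m) + p ^ suc k * σ m
σ-step {p} {m} pp p∤m k = begin
  sum (divisors (P * m))
    ≡⟨ sum-↭ (∼bag⇒↭ (unique∧set⇒bag (divisors-unique (P * m)) unique (mk⇔ split unsplit))) ⟩
  sum (old ++ new)                        ≡⟨ sum-++ old new ⟩
  σ (Q * m) + sum new                     ≡⟨ cong (σ (Q * m) +_) (sum-map-* P (divisors m)) ⟩
  σ (Q * m) + P * σ m                     ∎
  where
  open ≡-Reasoning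
  Q = p ^ k
  P = p ^ suc k
  old = divisors (Q * m)
  new = map (P *_) (divisors m)
  instance
    p≢0 : NonZero p
    p≢0 = prime⇒nonZero pp
    Q≢0 : NonZero Q
    Q≢0 = m^n≢0 p k
    P≢0 : NonZero P
    P≢0 = m^n≢0 p (suc k)
    Qm≢0 : NonZero (Q * m)
    Qm≢0 = m*n≢0 Q m
    Pm≢0 : NonZero (P * m)
    Pm≢0 = m*n≢0 P m
  split : ∀ {d} → d ∈ divisors (P * m) → d ∈ old ++ new
  split {d} d∈ with ∈-divisors⁻ d∈
  ... | divides q Pm≡qd with p ∣? q
  -- The cofactor `q` decides the side: if `p` divides `q`, one factor `p` cancels and `d` divides
  -- `Q * m`; otherwise the whole power `P` sits in `d`.
  ...   | yes (divides-refl e) = ∈-++⁺ˡ (∈-divisors⁺ (divides e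
            (*-cancelˡ-≡ (Q * m) (e * d) p
              (trans (sym (*-assoc p Q m)) (trans Pm≡qd (trans (cong (_* d) (*-comm e p)) (*-assoc p e d)))))))
  ...   | no p∤q with prime-power-divisor pp (suc k) {d} {q} p∤q (divides m (trans (trans (*-comm d q) (sym Pm≡qd)) (*-comm P m)))
  ...     | divides-refl e = ∈-++⁺ʳ old (subst (_∈ new) (*-comm P e)
              (∈-map⁺ (P *_) (∈-divisors⁺ {n = m} (*-cancelˡ-∣ P (subst (_∣ P * m) (*-comm e P) (divides q Pm≡qd))))))
  unsplit : ∀ {d} → d ∈ old ++ new → d ∈ divisors (P * m)
  unsplit {d} d∈ with ∈-++⁻ old d∈
  ... | inj₁ d∈old = ∈-divisors⁺ (subst (d ∣_) (sym (*-assoc p Q m)) (∣n⇒∣m*n p (∈-divisors⁻ d∈old)))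
  ... | inj₂ d∈new with ∈-map⁻ (P *_) d∈new
  ...   | e , e∈ , refl = ∈-divisors⁺ (*-monoʳ-∣ P (∈-divisors⁻ e∈))
  unique : Unique (old ++ new)
  unique = Unique.++⁺ (divisors-unique (Q * m))
    (Unique.map⁺ (*-cancelˡ-≡ _ _ P) (divisors-unique m)) disjoint
    where
    disjoint : ∀ {d} → ¬ (d ∈ old × d ∈ new)
    disjoint (d∈old , d∈new) with ∈-map⁻ (P *_) d∈new
    ... | e , _ , refl = p∤m (*-cancelˡ-∣ Q (subst (_∣ Q * m) (*-comm p Q)
            (∣-trans (m∣m*n e) (∈-divisors⁻ d∈old))))

-- With p = r + 1 this is (p - 1) σ(p^k m) = (p^(k+1) - 1) σ(m) without subtraction; `σ-step` makes
-- the sum telescope.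
σ-geometric : ∀ {r} → Prime (suc r) → .{{_ : NonZero m}} → ¬ suc r ∣ m → ∀ k →
  r * σ (suc r ^ k * m) + σ m ≡ suc r ^ suc k * σ m
σ-geometric {m} {r} pp p∤m zero rewrite *-identityˡ m | *-identityʳ r = +-comm (r * σ m) (σ m)
σ-geometric {m} {r} pp p∤m (suc k) = begin
  r * σ (P * m) + σ m              ≡⟨ cong (λ s → r * s + σ m) (σ-step pp p∤m k) ⟩
  r * (σ (Q * m) + P * σ m) + σ m  ≡⟨ regroup r (σ (Q * m)) (σ m) P ⟩
  (r * σ (Q * m) + σ m) + r * (P * σ m) ≡⟨ cong (_+ r * (P * σ m)) (σ-geometric pp p∤m k) ⟩
  P * σ m + r * (P * σ m)          ≡⟨ *-assoc (suc r) P (σ m) ⟨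
  suc r * P * σ m                  ∎
  where
  open ≡-Reasoning
  Q = suc r ^ k
  P = suc r ^ suc k
  regroup : ∀ r a b c → r * (a + c * b) + b ≡ (r * a + b) + r * (c * b)
  regroup = solve-∀

-- The Diophantine equation of the mixed case

-- The values of c for which the equation below has a solution in positive u and v.
vieta : List ℕ
vieta = 2 ∷ 3 ∷ 17 ∷ 23 ∷ 38 ∷ 56 ∷ 93 ∷ 119 ∷ 122 ∷ 246 ∷ 248 ∷ 497 ∷ []

Solution : ℕ → ℕ → ℕ → Set
Solution c u v = c * (u * v) + 499 ≡ u * (u + 2) + v * (v + 2)

solution-sym : ∀ c u v → Solution c u v → Solution c v u
solution-sym c u v eq =
  trans (cong (λ x → c * x + 499) (*-comm v u)) (trans eq (+-comm (u * (u + 2)) (v * (v + 2))))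

-- Indexed by u - 1 and v - 1, so that the divisor is visibly nonzero.
SmallQuotient : ℕ → ℕ → Set
SmallQuotient u v = 499 ≤ N → (N ∸ 499) % (suc u * suc v) ≡ 0 → (N ∸ 499) / (suc u * suc v) ∈ vieta
  where N = suc u * (suc u + 2) + suc v * (suc v + 2)

small-quotient? : ∀ u v → Dec (SmallQuotient u v)
small-quotient? u v = (_ ≤? _) →-dec (_ ≟ _) →-dec (_∈?_ _≟_ _ vieta)

-- A finite search; after the shift of indices it covers 1 ≤ u ≤ 21 and 1 ≤ v ≤ 499, the range that
-- `base-coefficient` leaves.
small-quotients : ∀ {u} → u < 21 → ∀ {v} → v < 499 → SmallQuotient u v
small-quotients = from-yes (allUpTo? (λ u → allUpTo? (small-quotient? u) 499) 21)

-- Modulo `v` the equation says that `v` divides 499 - u (u + 2). For u ≤ 21 this number is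
-- positive, since 21 · 23 = 483, so `v` is at most 499 and the search applies.
base-coefficient : ∀ c u v → 1 ≤ u → u ≤ 21 → 1 ≤ v → Solution c u v → c ∈ vieta
base-coefficient c u@(suc u′) v@(suc v′) _ u≤21 _ eq =
  subst (_∈ vieta) quotient-c (small-quotients u≤21 v≤499 (subst (499 ≤_) eq (m≤n+m 499 _))
    (trans (cong (_% (u * v)) N-499) (m*n%n≡0 c (u * v))))
  where
  N-499 : u * (u + 2) + v * (v + 2) ∸ 499 ≡ c * (u * v)
  N-499 = trans (cong (_∸ 499) (sym eq)) (m+n∸n≡m (c * (u * v)) 499)
  quotient-c : (u * (u + 2) + v * (v + 2) ∸ 499) / (u * v) ≡ c
  quotient-c = trans (/-congˡ {o = u * v} N-499) (m*n/n≡m c (u * v))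
  u[u+2]<499 : u * (u + 2) < 499
  u[u+2]<499 = ≤-<-trans (*-mono-≤ u≤21 (+-monoˡ-≤ 2 u≤21)) (from-yes (483 <? 499))
  s = 499 ∸ u * (u + 2)
  instance
    s≢0 : NonZero s
    s≢0 = >-nonZero (m<n⇒0<n∸m u[u+2]<499)
  regroup : ∀ a c s u v → v * (c * u) + s + a ≡ c * (u * v) + (a + s)
  regroup = solve-∀
  v[cu]+s : v * (c * u) + s ≡ v * (v + 2)
  v[cu]+s = +-cancelʳ-≡ (u * (u + 2)) _ _ (begin
    v * (c * u) + s + u * (u + 2)   ≡⟨ regroup (u * (u + 2)) c s u v ⟩
    c * (u * v) + (u * (u + 2) + s) ≡⟨ cong (c * (u * v) +_) (m+[n∸m]≡n (<⇒≤ u[u+2]<499)) ⟩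
    c * (u * v) + 499               ≡⟨ eq ⟩
    u * (u + 2) + v * (v + 2)       ≡⟨ +-comm (u * (u + 2)) _ ⟩
    v * (v + 2) + u * (u + 2)       ∎)
    where open ≡-Reasoning
  v≤499 : v ≤ 499
  v≤499 = ≤-trans (∣⇒≤ (∣m+n∣m⇒∣n (subst (v ∣_) (sym v[cu]+s) (m∣m*n (v + 2))) (m∣m*n (c * u))))
            (m∸n≤m 499 (u * (u + 2)))

-- The two roots v, v′ of the equation with c and u fixed satisfy v v′ = u (u + 2) - 499.
vieta-jump : ∀ c u v → 22 ≤ u → 1 ≤ v → Solution c u v →
  ∃[ v′ ] 1 ≤ v′ × v * v′ + 499 ≡ u * (u + 2) × Solution c v′ u
vieta-jump c u v@(suc _) 22≤u _ eq = conclude v∣r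
  where
  open ≡-Reasoning
  499<u[u+2] : 499 < u * (u + 2)
  -- 22 · 24 = 528, so from u = 22 on the product of the two roots is positive; this is why the
  -- descent stops at u ≤ 21.
  499<u[u+2] = <-≤-trans (from-yes (499 <? 528)) (*-mono-≤ 22≤u (+-monoˡ-≤ 2 22≤u))
  r = u * (u + 2) ∸ 499
  499+r : 499 + r ≡ u * (u + 2)
  499+r = m+[n∸m]≡n (<⇒≤ 499<u[u+2])
  v[cu] : v * (c * u) ≡ v * (v + 2) + r
  v[cu] = +-cancelʳ-≡ 499 _ _ (begin
    v * (c * u) + 499           ≡⟨ cong (_+ 499) (e₁ c u v) ⟩
    c * (u * v) + 499           ≡⟨ eq ⟩
    u * (u + 2) + v * (v + 2)   ≡⟨ cong (_+ v * (v + 2)) 499+r ⟨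
    499 + r + v * (v + 2)       ≡⟨ e₂ 499 (v * (v + 2)) r ⟩
    v * (v + 2) + r + 499       ∎)
    where
    e₁ : ∀ c u v → v * (c * u) ≡ c * (u * v)
    e₁ = solve-∀
    e₂ : ∀ t b r → t + r + b ≡ b + r + t
    e₂ = solve-∀
  v∣r : v ∣ r
  v∣r = ∣m+n∣m⇒∣n (subst (v ∣_) v[cu] (m∣m*n (c * u))) (m∣m*n (v + 2))
  conclude : v ∣ r → ∃[ v′ ] 1 ≤ v′ × v * v′ + 499 ≡ u * (u + 2) × Solution c v′ u
  conclude (divides v′ r≡) = v′ , n≢0⇒n>0 v′≢0 , product , jump
    where
    product : v * v′ + 499 ≡ u * (u + 2)
    product = begin
      v * v′ + 499 ≡⟨ cong (_+ 499) (trans (*-comm v v′) (sym r≡)) ⟩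
      r + 499      ≡⟨ +-comm r 499 ⟩
      499 + r      ≡⟨ 499+r ⟩
      u * (u + 2)  ∎
    v′≢0 : v′ ≢ 0
    v′≢0 v′≡0 = <-irrefl (trans (sym (cong (_+ 499) (trans (cong (v *_) v′≡0) (*-zeroʳ v)))) product) 499<u[u+2]
    -- The other Vieta relation: the two roots have sum c u - 2.
    cu≡ : c * u ≡ v′ + v + 2
    cu≡ = *-cancelˡ-≡ _ _ v (begin
      v * (c * u)         ≡⟨ v[cu] ⟩
      v * (v + 2) + r     ≡⟨ cong (v * (v + 2) +_) r≡ ⟩
      v * (v + 2) + v′ * v ≡⟨ e v v′ ⟩
      v * (v′ + v + 2)    ∎)
      where
      e : ∀ v v′ → v * (v + 2) + v′ * v ≡ v * (v′ + v + 2)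
      e = solve-∀
    jump : Solution c v′ u
    jump = begin
      c * (v′ * u) + 499             ≡⟨ cong (_+ 499) (e₁ c u v′) ⟩
      v′ * (c * u) + 499             ≡⟨ cong (λ x → v′ * x + 499) cu≡ ⟩
      v′ * (v′ + v + 2) + 499        ≡⟨ e₂ 499 v v′ ⟩
      v′ * (v′ + 2) + (v * v′ + 499) ≡⟨ cong (v′ * (v′ + 2) +_) product ⟩
      v′ * (v′ + 2) + u * (u + 2)    ∎
      where
      e₁ : ∀ c u v′ → c * (v′ * u) ≡ v′ * (c * u)
      e₁ = solve-∀
      e₂ : ∀ t v v′ → v′ * (v′ + v + 2) + t ≡ v′ * (v′ + 2) + (v * v′ + t)
      e₂ = solve-∀

-- On the diagonal the equation is c u² + 499 = 2u² + 4u. For c ≤ 1 the right side is too large, for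
-- c = 2 it would give 499 = 4u, and for c ≥ 3 the left side is too large because 4u ≤ u². This
-- removes the case in which a jump need not lower the larger entry.
no-diagonal-solution : ∀ c u → 22 ≤ u → ¬ Solution c u u
no-diagonal-solution 0 u 22≤u eq = from-no (528 ≤? 499) (begin
  528                       ≤⟨ *-mono-≤ 22≤u (+-monoˡ-≤ 2 22≤u) ⟩
  u * (u + 2)               ≤⟨ m≤m+n _ _ ⟩
  u * (u + 2) + u * (u + 2) ≡⟨ eq ⟨
  499                       ∎)
  where open ≤-Reasoning
no-diagonal-solution 1 u 22≤u eq = from-no (528 ≤? 499) (begin
  528                       ≤⟨ *-mono-≤ 22≤u (+-monoˡ-≤ 2 22≤u) ⟩
  u * (u + 2)               ≤⟨ m≤m+n _ _ ⟩
  u * (u + 2) + u * 2       ≡⟨ +-cancelˡ-≡ (1 * (u * u)) _ _ (trans (e u) (sym eq)) ⟩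
  499                       ∎)
  where
  open ≤-Reasoning
  e : ∀ u → 1 * (u * u) + (u * (u + 2) + u * 2) ≡ u * (u + 2) + u * (u + 2)
  e = solve-∀
no-diagonal-solution 2 u 22≤u eq =
  from-no (4 ∣? 499) (divides u (+-cancelˡ-≡ (2 * (u * u)) _ _ (trans eq (e u))))
  where
  e : ∀ u → u * (u + 2) + u * (u + 2) ≡ 2 * (u * u) + u * 4
  e = solve-∀
no-diagonal-solution (suc (suc (suc c))) u 22≤u eq = <-irrefl refl (begin-strict
  u * (u + 2) + u * (u + 2) ≡⟨ e₁ u ⟩
  2 * (u * u) + u * 4       ≤⟨ +-monoʳ-≤ (2 * (u * u)) (*-monoʳ-≤ u (≤-trans (from-yes (4 ≤? 22)) 22≤u)) ⟩
  2 * (u * u) + u * u       ≤⟨ m≤m+n _ _ ⟩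
  2 * (u * u) + u * u + c * (u * u) ≡⟨ e₂ c (u * u) ⟩
  (3 + c) * (u * u)         <⟨ m<m+n _ z<s ⟩
  (3 + c) * (u * u) + 499   ≡⟨ eq ⟩
  u * (u + 2) + u * (u + 2) ∎)
  where
  open ≤-Reasoning
  e₁ : ∀ u → u * (u + 2) + u * (u + 2) ≡ 2 * (u * u) + u * 4
  e₁ = solve-∀
  e₂ : ∀ c a → 2 * a + a + c * a ≡ (3 + c) * a
  e₂ = solve-∀

-- Descent on the larger entry: for 22 ≤ u < v a jump replaces (u, v) by (v′, u) with v′ ≤ u and the
-- same `c`, until the smaller entry is at most 21.
ordered-coefficient : ∀ v u c → 1 ≤ u → u ≤ v → Solution c u v → c ∈ vieta
ordered-coefficient = <-rec _ descend
  where
  descend : ∀ v → (∀ {w} → w < v → ∀ u c → 1 ≤ u → u ≤ w → Solution c u w → c ∈ vieta) →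
    ∀ u c → 1 ≤ u → u ≤ v → Solution c u v → c ∈ vieta
  descend v rec u c 1≤u u≤v eq with u ≤? 21 | m≤n⇒m<n∨m≡n u≤v
  ... | yes u≤21 | _         = base-coefficient c u v 1≤u u≤21 (≤-trans 1≤u u≤v) eq
  ... | no  u≰21 | inj₂ refl = contradiction eq (no-diagonal-solution c u (≰⇒> u≰21))
  ... | no  u≰21 | inj₁ u<v with vieta-jump c u v (≰⇒> u≰21) (≤-trans 1≤u u≤v) eq
  ...   | v′ , 1≤v′ , product , eq′ = rec u<v v′ c 1≤v′ (≮⇒≥ v′≯u) eq′
    where
    open ≤-Reasoning
    -- If both roots exceeded `u`, their product would be at least (u + 1)², whereas it equals u (u
    -- + 2) - 499.
    v′≯u : ¬ u < v′
    v′≯u u<v′ = <-irrefl refl (begin-strict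
      u * (u + 2)       <⟨ m<m+n (u * (u + 2)) z<s ⟩
      u * (u + 2) + 500 ≡⟨ e 499 u ⟩
      suc u * suc u + 499 ≤⟨ +-monoˡ-≤ 499 (*-mono-≤ u<v u<v′) ⟩
      v * v′ + 499      ≡⟨ product ⟩
      u * (u + 2)       ∎)
      where
      e : ∀ t u → u * (u + 2) + (1 + t) ≡ (1 + u) * (1 + u) + t
      e = solve-∀

coefficient : ∀ c u v → 1 ≤ u → 1 ≤ v → Solution c u v → c ∈ vieta
coefficient c u v 1≤u 1≤v eq with ≤-total u v
... | inj₁ u≤v = ordered-coefficient v u c 1≤u u≤v eq
... | inj₂ v≤u = ordered-coefficient u v c 1≤v v≤u (solution-sym c u v eq)

-- The obstruction modulo 504

geometric-residue : ∀ m .{{_ : NonZero m}} b s {L} →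
  All (λ x → (x * b) % m ∈ L) L → s % m ∈ L → ∀ k → (s * b ^ k) % m ∈ L
geometric-residue m b s {L} closed s∈L zero = subst (λ x → x % m ∈ L) (sym (*-identityʳ s)) s∈L
geometric-residue m b s {L} closed s∈L (suc k) = subst (_∈ L) (begin
  ((s * b ^ k) % m * b) % m  ≡⟨ [m%n*o]%n≡[m*o]%n (s * b ^ k) b ⟩
  (s * b ^ k * b) % m        ≡⟨ cong (_% m) (e s (b ^ k) b) ⟩
  (s * (b * b ^ k)) % m      ∎)
  (All.lookup closed (geometric-residue m b s closed s∈L k))
  where
  open ≡-Reasoning
  e : ∀ s x b → s * x * b ≡ s * (b * x)
  e = solve-∀
  [m%n*o]%n≡[m*o]%n : ∀ x y → (x % m * y) % m ≡ (x * y) % m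
  [m%n*o]%n≡[m*o]%n x y = trans (%-distribˡ-* (x % m) y m)
    (trans (cong (λ z → (z * (y % m)) % m) (m%n%n≡m%n x m)) (sym (%-distribˡ-* x y m)))

-- Solution c u v in terms of x = u + 1 and y = v + 1, with c (x + y) added to
-- both sides so that no subtraction occurs.
lhs rhs : ℕ → ℕ → ℕ → ℕ
lhs c x y = c * (x * y) + (c + 501)
rhs c x y = x * x + y * y + c * (x + y)

lhs-% : ∀ m .{{_ : NonZero m}} c x y → lhs c x y % m ≡ lhs c (x % m) (y % m) % m
lhs-% m c x y = begin
  lhs c x y % m                            ≡⟨ cong₂ (λ x y → lhs c x y % m) (m≡m%n+[m/n]*n x m) (m≡m%n+[m/n]*n y m) ⟩
  lhs c (x₀ + i * m) (y₀ + j * m) % m      ≡⟨ cong (_% m) (e (c + 501) c m x₀ i y₀ j) ⟩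
  (lhs c x₀ y₀ + t * m) % m                ≡⟨ [m+kn]%n≡m%n (lhs c x₀ y₀) t m ⟩
  lhs c x₀ y₀ % m                          ∎
  where
  open ≡-Reasoning
  x₀ = x % m
  y₀ = y % m
  i = x / m
  j = y / m
  t = c * (x₀ * j + i * y₀ + i * j * m)
  e : ∀ t c m x i y j → c * ((x + i * m) * (y + j * m)) + t ≡
    c * (x * y) + t + c * (x * j + i * y + i * j * m) * m
  e = solve-∀

rhs-% : ∀ m .{{_ : NonZero m}} c x y → rhs c x y % m ≡ rhs c (x % m) (y % m) % m
rhs-% m c x y = begin
  rhs c x y % m                            ≡⟨ cong₂ (λ x y → rhs c x y % m) (m≡m%n+[m/n]*n x m) (m≡m%n+[m/n]*n y m) ⟩
  rhs c (x₀ + i * m) (y₀ + j * m) % m      ≡⟨ cong (_% m) (e c m x₀ i y₀ j) ⟩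
  (rhs c x₀ y₀ + t * m) % m                ≡⟨ [m+kn]%n≡m%n (rhs c x₀ y₀) t m ⟩
  rhs c x₀ y₀ % m                          ∎
  where
  open ≡-Reasoning
  x₀ = x % m
  y₀ = y % m
  i = x / m
  j = y / m
  t = (x₀ + x₀ + i * m) * i + (y₀ + y₀ + j * m) * j + c * (i + j)
  e : ∀ c m x i y j → (x + i * m) * (x + i * m) + (y + j * m) * (y + j * m) + c * ((x + i * m) + (y + j * m)) ≡
    x * x + y * y + c * (x + y) + ((x + x + i * m) * i + (y + y + j * m) * j + c * (i + j)) * m
  e = solve-∀

-- Modulo 504 = 8 · 63 both progressions have period 3: 4³ = 64 is 1 modulo 63, and 25³ = 1 + 31 ·
-- 504.
residues-8·4ᵏ residues-125·25ᵏ : List ℕ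
residues-8·4ᵏ    = 8 ∷ 32 ∷ 128 ∷ []
residues-125·25ᵏ = 125 ∷ 101 ∷ 5 ∷ []

obstruction : All (λ c → All (λ x → All (λ y → lhs c x y % 504 ≢ rhs c x y % 504)
  residues-125·25ᵏ) residues-8·4ᵏ) vieta
obstruction = from-yes (all? (λ c → all? (λ x → all? (λ y → ¬? (lhs c x y % 504 ≟ rhs c x y % 504))
  residues-125·25ᵏ) residues-8·4ᵏ) vieta)

no-geometric-solution : ∀ c u v p q → suc u ≡ 8 * 4 ^ p → suc v ≡ 125 * 25 ^ q →
  1 ≤ u → 1 ≤ v → ¬ Solution c u v
no-geometric-solution c u v p q x≡ y≡ 1≤u 1≤v eq =
  All.lookup (All.lookup (All.lookup obstruction (coefficient c u v 1≤u 1≤v eq)) x∈) y∈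
    (trans (sym (lhs-% 504 c (suc u) (suc v))) (trans (cong (_% 504) shifted) (rhs-% 504 c (suc u) (suc v))))
  where
  x∈ : suc u % 504 ∈ residues-8·4ᵏ
  x∈ = subst (λ x → x % 504 ∈ residues-8·4ᵏ) (sym x≡)
    (geometric-residue 504 4 8 (from-yes (all? (λ x → _∈?_ _≟_ (x * 4 % 504) residues-8·4ᵏ) residues-8·4ᵏ)) (here refl) p)
  y∈ : suc v % 504 ∈ residues-125·25ᵏ
  y∈ = subst (λ y → y % 504 ∈ residues-125·25ᵏ) (sym y≡)
    (geometric-residue 504 25 125 (from-yes (all? (λ y → _∈?_ _≟_ (y * 25 % 504) residues-125·25ᵏ) residues-125·25ᵏ)) (here refl) q)
  e₁ : ∀ t c u v → c * ((1 + u) * (1 + v)) + (c + (2 + t)) ≡ c * (u * v) + t + (2 + c * ((1 + u) + (1 + v)))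
  e₁ = solve-∀
  e₂ : ∀ c u v → u * (u + 2) + v * (v + 2) + (2 + c * ((1 + u) + (1 + v))) ≡
    (1 + u) * (1 + u) + (1 + v) * (1 + v) + c * ((1 + u) + (1 + v))
  e₂ = solve-∀
  -- Adding 2 + c (x + y) to both sides completes the squares u (u + 2) + 1 and v (v + 2) + 1, and
  -- turns c u v into c x y + c.
  shifted : lhs c (suc u) (suc v) ≡ rhs c (suc u) (suc v)
  shifted = trans (e₁ 499 c u v) (trans (cong (_+ (2 + c * (suc u + suc v))) eq) (e₂ c u v))

-- Congruences for powers, and the moduli of the pure cases

1+r-power : ∀ r k → ∃[ j ] suc r ^ k ≡ 1 + r * j
1+r-power r zero    = 0 , cong suc (sym (*-zeroʳ r))
1+r-power r (suc k) with 1+r-power r k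
... | j , eq = 1 + j + r * j , trans (cong (suc r *_) eq) (e r j)
  where
  e : ∀ r j → (1 + r) * (1 + r * j) ≡ 1 + r * (1 + j + r * j)
  e = solve-∀

even-or-odd : ∀ n → (∃[ k ] n ≡ 2 * k) ⊎ (∃[ k ] n ≡ suc (2 * k))
even-or-odd zero    = inj₁ (0 , refl)
even-or-odd (suc n) with even-or-odd n
... | inj₁ (k , refl) = inj₂ (k , refl)
... | inj₂ (k , refl) = inj₁ (suc k , cong suc (sym (+-suc k (k + 0))))

-- 40 is 1 modulo 3, and 2 is not a square modulo 3.
40t²≢2-mod-3 : ∀ t j → 40 * (t * t) ≢ 2 + j * 3
40t²≢2-mod-3 t j eq = squares (m%n<n t 3) (begin
  ((t % 3) * (t % 3)) % 3        ≡⟨ %-distribˡ-* t t 3 ⟨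
  (t * t) % 3                    ≡⟨ [m+kn]%n≡m%n (t * t) (13 * (t * t)) 3 ⟨
  (t * t + 13 * (t * t) * 3) % 3 ≡⟨ cong (_% 3) (e (t * t)) ⟩
  (40 * (t * t)) % 3             ≡⟨ cong (_% 3) eq ⟩
  (2 + j * 3) % 3                ≡⟨ [m+kn]%n≡m%n 2 j 3 ⟩
  2                              ∎)
  where
  open ≡-Reasoning
  squares : ∀ {r} → r < 3 → (r * r) % 3 ≢ 2
  squares = from-yes (allUpTo? (λ r → ¬? ((r * r) % 3 ≟ 2)) 3)
  e : ∀ x → x + 13 * x * 3 ≡ 40 * x
  e = solve-∀

-- Here n = 2z and φ(n) = z. Modulo `M` one has 4z ≡ 1, so eight times the equation, 16z² ≡ 16,
-- becomes 1 ≡ 16.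
power-of-2-modulus : ∀ z k M → suc M ≡ 4 * z → 2 * (z * z) ≡ 2 + k * M → M ∣ 15
power-of-2-modulus z k M M+1 eq = ∣m+n∣m⇒∣n (subst (M ∣_) M[2+M] (m∣m*n (2 + M))) (n∣m*n (8 * k))
  where
  open ≡-Reasoning
  e₁ : ∀ M → 1 + M * (2 + M) ≡ (1 + M) * (1 + M)
  e₁ = solve-∀
  e₂ : ∀ z → 4 * z * (4 * z) ≡ 8 * (2 * (z * z))
  e₂ = solve-∀
  e₃ : ∀ k M → 8 * (2 + k * M) ≡ 1 + (8 * k * M + 15)
  e₃ = solve-∀
  M[2+M] : M * (2 + M) ≡ 8 * k * M + 15
  M[2+M] = suc-injective (begin
    1 + M * (2 + M)      ≡⟨ e₁ M ⟩
    suc M * suc M        ≡⟨ cong₂ _*_ M+1 M+1 ⟩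
    4 * z * (4 * z)      ≡⟨ e₂ z ⟩
    8 * (2 * (z * z))    ≡⟨ cong (8 *_) eq ⟩
    8 * (2 + k * M)      ≡⟨ e₃ k M ⟩
    1 + (8 * k * M + 15) ∎)

-- Here n = 5w and φ(n) = 4w. Modulo `S` one has 25w ≡ 1, so 125 times the equation, 4 (25w)² ≡ 250,
-- becomes 4 ≡ 250.
power-of-5-modulus : ∀ w k S → 4 * S + 1 ≡ 25 * w → 20 * (w * w) ≡ 2 + k * S → S ∣ 246
power-of-5-modulus w k S 4S+1 eq =
  ∣m+n∣m⇒∣n (subst (S ∣_) (trans multiple (+-comm 246 _)) (m∣m*n (4 * (16 * S + 8)))) (∣n⇒∣m*n 125 (n∣m*n k))
  where
  open ≡-Reasoning
  e₁ : ∀ S → 4 + S * (4 * (16 * S + 8)) ≡ 4 * ((4 * S + 1) * (4 * S + 1))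
  e₁ = solve-∀
  e₂ : ∀ f w → 4 * (f * f * w * (f * f * w)) ≡ f * f * f * (4 * f * (w * w))
  e₂ = solve-∀
  multiple : S * (4 * (16 * S + 8)) ≡ 246 + 125 * (k * S)
  multiple = +-cancelˡ-≡ 4 _ _ (begin
    4 + S * (4 * (16 * S + 8))        ≡⟨ e₁ S ⟩
    4 * ((4 * S + 1) * (4 * S + 1))   ≡⟨ cong (4 *_) (cong₂ _*_ 4S+1 4S+1) ⟩
    4 * (25 * w * (25 * w))           ≡⟨ e₂ 5 w ⟩
    125 * (20 * (w * w))              ≡⟨ cong (125 *_) eq ⟩
    125 * (2 + k * S)                 ≡⟨ *-distribˡ-+ 125 2 (k * S) ⟩
    250 + 125 * (k * S)               ∎)

-- The mixed case: reduction to the Diophantine equation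

module Mixed (a b k M S : ℕ) (M+1 : suc M ≡ 4 * 2 ^ a) (4S+1 : 4 * S + 1 ≡ 25 * 5 ^ b)
  (eq : 40 * (2 ^ a * 5 ^ b * (2 ^ a * 5 ^ b)) ≡ 2 + k * (M * S)) where

  open ≡-Reasoning

  -- The left side of `eq` is n φ(n) for n = 2^(a+1) 5^(b+1), which is 40 times a square. Hence
  -- neither `M` nor `S` may be divisible by 3.
  3∤MS : ¬ 3 ∣ k * (M * S)
  3∤MS (divides j kMS) = 40t²≢2-mod-3 (2 ^ a * 5 ^ b) j (trans eq (cong (2 +_) kMS))

  -- The exponent of 2 in n is a + 1, so this makes it even. For even `a`, M + 1 would be a power of
  -- 4, thus 1 modulo 3, and 3 would divide `M`.
  a-odd : ∃[ p ] a ≡ suc (2 * p)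
  a-odd with even-or-odd a
  ... | inj₂ odd = odd
  ... | inj₁ (p , refl) with 1+r-power 3 p
  ...   | i , 4ᵖ = contradiction (∣n⇒∣m*n k (∣m⇒∣m*n S (divides (1 + 4 * i) (suc-injective (begin
    suc M              ≡⟨ M+1 ⟩
    4 * 2 ^ (2 * p)    ≡⟨ cong (4 *_) (^-*-assoc 2 2 p) ⟨
    4 * 4 ^ p          ≡⟨ cong (4 *_) 4ᵖ ⟩
    4 * (1 + 3 * i)    ≡⟨ e i ⟩
    1 + (1 + 4 * i) * 3 ∎))))) 3∤MS
    where
    e : ∀ i → 4 * (1 + 3 * i) ≡ 1 + (1 + 4 * i) * 3
    e = solve-∀

  -- For even `b`, 4S + 1 would be a power of 25, thus 1 modulo 24; then 6, and in particular 3,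
  -- would divide `S`.
  b-odd : ∃[ q ] b ≡ suc (2 * q)
  b-odd with even-or-odd b
  ... | inj₂ odd = odd
  ... | inj₁ (q , refl) with 1+r-power 24 q
  ...   | j , 25^q = contradiction (∣n⇒∣m*n k (∣n⇒∣m*n M (divides (2 + 50 * j)
    (*-cancelˡ-≡ _ _ 4 (+-cancelʳ-≡ 1 _ _ (begin
    4 * S + 1                      ≡⟨ 4S+1 ⟩
    25 * 5 ^ (2 * q)               ≡⟨ cong (25 *_) (^-*-assoc 5 2 q) ⟨
    25 * 25 ^ q                    ≡⟨ cong (25 *_) 25^q ⟩
    25 * (1 + 24 * j)              ≡⟨ e j ⟩
    4 * ((2 + 50 * j) * 3) + 1     ∎)))))) 3∤MS
    where
    e : ∀ j → 25 * (1 + 24 * j) ≡ 4 * ((2 + 50 * j) * 3) + 1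
    e = solve-∀

  a/2 = proj₁ a-odd
  b/2 = proj₁ b-odd
  v = 4 * S

  x≡ : suc M ≡ 8 * 4 ^ a/2
  x≡ = begin
    suc M                 ≡⟨ M+1 ⟩
    4 * 2 ^ a             ≡⟨ cong (λ a → 4 * 2 ^ a) (proj₂ a-odd) ⟩
    4 * (2 * 2 ^ (2 * a/2)) ≡⟨ *-assoc 4 2 (2 ^ (2 * a/2)) ⟨
    8 * 2 ^ (2 * a/2)       ≡⟨ cong (8 *_) (^-*-assoc 2 2 a/2) ⟨
    8 * 4 ^ a/2             ∎

  y≡ : 4 * S + 1 ≡ 125 * 25 ^ b/2
  y≡ = begin
    4 * S + 1              ≡⟨ 4S+1 ⟩
    25 * 5 ^ b             ≡⟨ cong (λ b → 25 * 5 ^ b) (proj₂ b-odd) ⟩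
    25 * (5 * 5 ^ (2 * b/2)) ≡⟨ *-assoc 25 5 (5 ^ (2 * b/2)) ⟨
    125 * 5 ^ (2 * b/2)      ≡⟨ cong (125 *_) (^-*-assoc 5 2 b/2) ⟨
    125 * 25 ^ b/2           ∎

  -- Provides both the oddness of `S` and the bound S ≥ 31.
  S≡ : ∃[ j ] S ≡ 31 + 750 * j
  S≡ with 1+r-power 24 b/2
  ... | j , 25^q = j , *-cancelˡ-≡ _ _ 4 (+-cancelʳ-≡ 1 _ _ (trans y≡ (trans (cong (125 *_) 25^q) (e j))))
    where
    e : ∀ j → 125 * (1 + 24 * j) ≡ 4 * (31 + 750 * j) + 1
    e = solve-∀

  2∤M : ¬ 2 ∣ M
  2∤M 2∣M = from-no (2 ∣? 1) (∣m+n∣m⇒∣n (subst (2 ∣_) (trans (sym x≡) (+-comm 1 M))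
    (∣m⇒∣m*n {2} {8} (4 ^ a/2) (divides 4 refl))) 2∣M)

  2∤S : ¬ 2 ∣ S
  2∤S 2∣S = from-no (2 ∣? 31) (∣m+n∣m⇒∣n
    (subst (2 ∣_) (trans (proj₂ S≡) (+-comm 31 _)) 2∣S) (∣m⇒∣m*n {2} {750} (proj₁ S≡) (divides 375 refl)))

  2∣kMS : 2 ∣ k * (M * S)
  2∣kMS = ∣m+n∣m⇒∣n {2} {2} {k * (M * S)} (subst (2 ∣_) eq 2∣40t²) ∣-refl
    where
    2∣40t² : 2 ∣ 40 * (2 ^ a * 5 ^ b * (2 ^ a * 5 ^ b))
    2∣40t² = ∣m⇒∣m*n {2} {40} (2 ^ a * 5 ^ b * (2 ^ a * 5 ^ b)) (divides 20 refl)

  2∣k : 2 ∣ k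
  2∣k = fromInj₁ ([ flip contradiction 2∤M , flip contradiction 2∤S ]′ ∘ euclidsLemma M S prime[2])
    (euclidsLemma k (M * S) prime[2] 2∣kMS)

  h = quotient 2∣k
  P = 125 * h
  Q = (M + 2) * (v + 2)
  N = M * (M + 2) + v * (v + 2)

  -- This is 250 times `eq`: since 250 · 40 = (4 · 25)², the left side becomes (M + 1)² (v + 1)²,
  -- that is, (M (M + 2) + 1) (v (v + 2) + 1). Evenness of `k` turns 250 k M S into 125 h · M v, a
  -- multiple of M v.
  expanded : Q * (M * v) + N ≡ P * (M * v) + 499
  expanded = suc-injective (begin
    1 + (Q * (M * v) + N)                      ≡⟨ e₁ M v ⟩
    (1 + M) * (1 + M) * ((v + 1) * (v + 1))    ≡⟨ cong₂ _*_ (cong₂ _*_ M+1 M+1) (cong₂ _*_ 4S+1 4S+1) ⟩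
    4 * z * (4 * z) * (25 * w * (25 * w))      ≡⟨ e₂ 5 z w ⟩
    250 * (40 * (z * w * (z * w)))             ≡⟨ cong (250 *_) eq ⟩
    250 * (2 + k * (M * S))                    ≡⟨ *-distribˡ-+ 250 2 (k * (M * S)) ⟩
    500 + 250 * (k * (M * S))                  ≡⟨ cong (λ k → 500 + 250 * (k * (M * S))) (m∣n⇒n≡quotient*m 2∣k) ⟩
    500 + 250 * (h * 2 * (M * S))              ≡⟨ cong (500 +_) (e₃ 125 h M S) ⟩
    500 + P * (M * v)                          ≡⟨ +-comm 500 (P * (M * v)) ⟩
    P * (M * v) + 500                          ≡⟨ +-suc (P * (M * v)) 499 ⟩
    1 + (P * (M * v) + 499)                    ∎)
    where
    z = 2 ^ a
    w = 5 ^ b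
    e₁ : ∀ u v → 1 + ((u + 2) * (v + 2) * (u * v) + (u * (u + 2) + v * (v + 2))) ≡
      (1 + u) * (1 + u) * ((v + 1) * (v + 1))
    e₁ = solve-∀
    e₂ : ∀ f z w → 4 * z * (4 * z) * (f * f * w * (f * f * w)) ≡ 2 * (f * f * f) * (8 * f * (z * w * (z * w)))
    e₂ = solve-∀
    e₃ : ∀ g h M S → 2 * g * (h * 2 * (M * S)) ≡ g * h * (M * (4 * S))
    e₃ = solve-∀

  124≤v : 124 ≤ v
  124≤v = *-monoʳ-≤ 4 (subst (31 ≤_) (sym (proj₂ S≡)) (m≤m+n 31 _))

  499<N : 499 < N
  499<N = <-≤-trans (from-yes (499 <? 15624))
    (≤-trans (*-mono-≤ 124≤v (+-monoˡ-≤ 2 124≤v)) (m≤n+m (v * (v + 2)) (M * (M + 2))))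

  -- As N > 499, P < Q would make the left side of `expanded` the larger one. So `P ∸ Q`, the
  -- coefficient of the solution, is a true difference.
  Q≤A : Q ≤ P
  Q≤A = ≮⇒≥ (λ P<Q → <-irrefl (sym expanded) (+-mono-≤-< (*-monoˡ-≤ (M * v) (<⇒≤ P<Q)) 499<N))

  solution : Solution (P ∸ Q) M v
  solution = +-cancelˡ-≡ (Q * (M * v)) _ _ (begin
    Q * (M * v) + ((P ∸ Q) * (M * v) + 499) ≡⟨ e Q (P ∸ Q) (M * v) 499 ⟩
    (Q + (P ∸ Q)) * (M * v) + 499           ≡⟨ cong (λ x → x * (M * v) + 499) (m+[n∸m]≡n Q≤A) ⟩
    P * (M * v) + 499                       ≡⟨ expanded ⟨
    Q * (M * v) + N                         ∎)
    where
    e : ∀ b c x t → b * x + (c * x + t) ≡ (b + c) * x + t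
    e = solve-∀

  absurd : ⊥
  absurd = no-geometric-solution (P ∸ Q) M v a/2 b/2 x≡ (trans (+-comm 1 v) y≡)
    (n≢0⇒n>0 (λ M≡0 → 2∤M (subst (2 ∣_) (sym M≡0) (2 ∣0)))) (≤-trans (s≤s z≤n) 124≤v) solution

-- From the congruence to equations between natural numbers

∣+a-+b∣ : ∀ {a b} → b ≤ a → ℤ.∣ ℤ.+ a ℤ.- ℤ.+ b ∣ ≡ a ∸ b
∣+a-+b∣ {a} {b} b≤a = cong ℤ.∣_∣ (trans (ℤ.m-n≡m⊖n a b) (ℤ.⊖-≥ b≤a))

congruence⇒quotient : ∀ {a b m} → b ≤ a → a ≡ b [mod m ] → ∃[ k ] a ≡ b + k * m
congruence⇒quotient {a} {b} b≤a (divides k eq) =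
  k , trans (sym (m+[n∸m]≡n b≤a)) (cong (b +_) (trans (sym (∣+a-+b∣ b≤a)) eq))

5-prime : Prime 5
5-prime = from-yes (prime? 5)

2∤5^ : ∀ b → ¬ 2 ∣ 5 ^ b
2∤5^ zero    = from-no (2 ∣? 1)
2∤5^ (suc b) 2∣ with euclidsLemma 5 (5 ^ b) prime[2] 2∣
... | inj₁ 2∣5 = from-no (2 ∣? 5) 2∣5
... | inj₂ 2∣5^b = 2∤5^ b 2∣5^b

σ-5^ : ∀ b → 4 * σ (5 ^ b) + 1 ≡ 5 ^ suc b
σ-5^ b = begin
  4 * σ (5 ^ b) + 1     ≡⟨ cong (λ x → 4 * σ x + 1) (*-identityʳ (5 ^ b)) ⟨
  4 * σ (5 ^ b * 1) + 1 ≡⟨ σ-geometric 5-prime (from-no (5 ∣? 1)) b ⟩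
  5 ^ suc b * 1         ≡⟨ *-identityʳ (5 ^ suc b) ⟩
  5 ^ suc b             ∎
  where open ≡-Reasoning

σ-2^5^ : ∀ a b → σ (2 ^ a * 5 ^ b) ≡ pred (2 ^ suc a) * σ (5 ^ b)
σ-2^5^ a b = +-cancelʳ-≡ S _ _ (begin
  σ (2 ^ a * 5 ^ b) + S       ≡⟨ cong (_+ S) (*-identityˡ _) ⟨
  1 * σ (2 ^ a * 5 ^ b) + S   ≡⟨ σ-geometric prime[2] (2∤5^ b) a ⟩
  2 ^ suc a * S               ≡⟨ cong (_* S) (suc-pred (2 ^ suc a)) ⟨
  S + pred (2 ^ suc a) * S    ≡⟨ +-comm S _ ⟩
  pred (2 ^ suc a) * S + S    ∎)
  where
  open ≡-Reasoning
  S = σ (5 ^ b)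
  instance
    _ = m^n≢0 2 (suc a)
    _ = m^n≢0 5 b

Target : ℕ → Set
Target n = n ≡ 1 ⊎ n ≡ 2 ⊎ n ≡ 5 ⊎ n ≡ 8

Congruence : ℕ → Set
Congruence n = n * φ n ≡ 2 [mod σ n ]

-- Writing n φ(n) as 2t with t nonzero guarantees n φ(n) ≥ 2, so the integer difference is
-- nonnegative and its quotient by σ(n) yields an equation in ℕ.
congruence-quotient : ∀ n {s} t .{{_ : NonZero t}} → n * φ n ≡ 2 * t → σ n ≡ s → Congruence n →
  ∃[ k ] 2 * t ≡ 2 + k * s
congruence-quotient n t nφ[n] refl hyp =
  congruence⇒quotient {m = σ n} (m≤m*n 2 t) (subst (_≡ 2 [mod σ n ]) nφ[n] hyp)

m^n≥m^o : ∀ m .{{_ : NonZero m}} o k → m ^ o ≤ m ^ (o + k)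
m^n≥m^o m o k = ^-monoʳ-≤ m (m≤m+n o k)

-- The cases of the exponents

powers-of-2 : ∀ a → Congruence (2 ^ suc a * 5 ^ 0) → Target (2 ^ suc a * 5 ^ 0)
powers-of-2 a hyp = finish a (power-of-2-modulus z (proj₁ quot) M M+1 (proj₂ quot))
  where
  open ≡-Reasoning
  z = 2 ^ a
  M = pred (2 ^ suc (suc a))
  instance
    z≢0 : NonZero z
    z≢0 = m^n≢0 2 a
    zz≢0 : NonZero (z * z)
    zz≢0 = m*n≢0 z z
    2z≢0 : NonZero (2 ^ suc (suc a))
    2z≢0 = m^n≢0 2 (suc (suc a))
  M+1 : suc M ≡ 4 * z
  M+1 = trans (suc-pred (2 ^ suc (suc a))) (sym (*-assoc 2 2 z))
  e₁ : ∀ z → 2 * z * 1 ≡ z * 2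
  e₁ = solve-∀
  e₂ : ∀ z → 2 * z * 1 * (z * 1) ≡ 2 * (z * z)
  e₂ = solve-∀
  quot : ∃[ k ] 2 * (z * z) ≡ 2 + k * M
  quot = congruence-quotient (2 * z * 1) (z * z)
    (trans (cong (2 * z * 1 *_) (trans (cong φ (e₁ z)) (φ-power {2} {2} ∣-refl a))) (e₂ z))
    (trans (σ-2^5^ (suc a) 0) (*-identityʳ M)) hyp
  finish : ∀ a → pred (2 ^ suc (suc a)) ∣ 15 → Target (2 ^ suc a * 5 ^ 0)
  -- The modulus is 3, 7, 15 for n = 2, 4, 8, and at least 31 afterwards.
  finish 0 _    = inj₂ (inj₁ refl)
  finish 1 7∣15 = contradiction 7∣15 (from-no (7 ∣? 15))
  finish 2 _    = inj₂ (inj₂ (inj₂ refl))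
  finish (suc (suc (suc a))) M∣15 = contradiction
    (≤-trans (pred-mono-≤ (m^n≥m^o 2 5 a)) (∣⇒≤ M∣15)) (from-no (31 ≤? 15))

powers-of-5 : ∀ b → Congruence (2 ^ 0 * 5 ^ suc b) → Target (2 ^ 0 * 5 ^ suc b)
powers-of-5 b hyp = finish b (σ-5^ (suc b))
  (power-of-5-modulus w (proj₁ quot) S (trans (σ-5^ (suc b)) (sym (*-assoc 5 5 w)))
    (trans (*-assoc 2 10 (w * w)) (proj₂ quot)))
  where
  w = 5 ^ b
  S = σ (5 ^ suc b)
  instance
    w≢0 : NonZero w
    w≢0 = m^n≢0 5 b
    ww≢0 : NonZero (w * w)
    ww≢0 = m*n≢0 w w
    10ww≢0 : NonZero (10 * (w * w))
    10ww≢0 = m*n≢0 10 (w * w)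
  e₁ : ∀ w → 1 * (5 * w) ≡ w * 5
  e₁ = solve-∀
  e₂ : ∀ w → 1 * (5 * w) * (w * 4) ≡ 2 * (10 * (w * w))
  e₂ = solve-∀
  quot : ∃[ k ] 2 * (10 * (w * w)) ≡ 2 + k * S
  quot = congruence-quotient (1 * (5 * w)) (10 * (w * w))
    (trans (cong (1 * (5 * w) *_) (trans (cong φ (e₁ w)) (φ-power {5} {5} ∣-refl b))) (e₂ w))
    (trans (σ-2^5^ 0 (suc b)) (*-identityˡ S)) hyp
  S-value : ∀ {s} t → 4 * s + 1 ≡ 4 * t + 1 → s ≡ t
  S-value t eq = *-cancelˡ-≡ _ t 4 (+-cancelʳ-≡ 1 _ _ eq)
  finish : ∀ b {s} → 4 * s + 1 ≡ 5 ^ suc (suc b) → s ∣ 246 → Target (2 ^ 0 * 5 ^ suc b)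
  -- σ(n) is 6, 31, 156 for n = 5, 25, 125. Later 4s + 1 is at least 5⁵ = 3125, while s ≤ 246 gives
  -- 4s + 1 ≤ 985.
  finish 0 _ _        = inj₂ (inj₂ (inj₁ refl))
  finish 1 eq s∣246 = contradiction (subst (_∣ 246) (S-value 31 eq) s∣246) (from-no (31 ∣? 246))
  finish 2 eq s∣246 = contradiction (subst (_∣ 246) (S-value 156 eq) s∣246) (from-no (156 ∣? 246))
  finish (suc (suc (suc b))) eq s∣246 = contradiction
    (≤-trans (m^n≥m^o 5 5 b) (subst (_≤ 985) eq (+-monoˡ-≤ 1 (*-monoʳ-≤ 4 (∣⇒≤ s∣246)))))
    (from-no (3125 ≤? 985))

no-mixed-powers : ∀ a b → ¬ Congruence (2 ^ suc a * 5 ^ suc b)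
no-mixed-powers a b hyp = Mixed.absurd a b (proj₁ quot) M S M+1
  (trans (σ-5^ (suc b)) (sym (*-assoc 5 5 w))) (trans (*-assoc 2 20 (t * t)) (proj₂ quot))
  where
  z = 2 ^ a
  w = 5 ^ b
  t = z * w
  M = pred (2 ^ suc (suc a))
  S = σ (5 ^ suc b)
  instance
    z≢0 : NonZero z
    z≢0 = m^n≢0 2 a
    w≢0 : NonZero w
    w≢0 = m^n≢0 5 b
    t≢0 : NonZero t
    t≢0 = m*n≢0 z w
    tt≢0 : NonZero (t * t)
    tt≢0 = m*n≢0 t t
    20tt≢0 : NonZero (20 * (t * t))
    20tt≢0 = m*n≢0 20 (t * t)
    4z≢0 : NonZero (2 ^ suc (suc a))
    4z≢0 = m^n≢0 2 (suc (suc a))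
  M+1 : suc M ≡ 4 * z
  M+1 = trans (suc-pred (2 ^ suc (suc a))) (sym (*-assoc 2 2 z))
  e₁ : ∀ z w → 2 * z * (5 * w) ≡ z * (w * 10)
  e₁ = solve-∀
  e₂ : ∀ z w → 2 * z * (5 * w) * (z * (w * 4)) ≡ 2 * (20 * (z * w * (z * w)))
  e₂ = solve-∀
  -- One factor 2 and one factor 5 stay behind so that `φ-power` can remove 2^a and 5^b; what
  -- remains is φ(10) = 4.
  φ-value : φ (2 * z * (5 * w)) ≡ z * (w * 4)
  φ-value = begin
    φ (2 * z * (5 * w)) ≡⟨ cong φ (e₁ z w) ⟩
    φ (z * (w * 10))    ≡⟨ φ-power {2} {w * 10} (∣n⇒∣m*n w (divides 5 refl)) a ⟩
    z * φ (w * 10)      ≡⟨ cong (z *_) (φ-power {5} {10} (divides 2 refl) b) ⟩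
    z * (w * 4)         ∎
    where open ≡-Reasoning
  quot : ∃[ k ] 2 * (20 * (t * t)) ≡ 2 + k * (M * S)
  quot = congruence-quotient (2 * z * (5 * w)) (20 * (t * t))
    (trans (cong (2 * z * (5 * w) *_) φ-value) (e₂ z w)) (σ-2^5^ (suc a) (suc b)) hyp

theorem1 : (n : ℕ) → n ≥ 1 →
    ((∃[ α ] ∃[ β ] n ≡ 2 ^ α * 5 ^ β) × n * φ n ≡ 2 [mod σ n ]) ⇔
    (n ≡ 1 ⊎ n ≡ 2 ⊎ n ≡ 5 ⊎ n ≡ 8)
theorem1 n _ = mk⇔ only-if if
  where
  only-if : (∃[ α ] ∃[ β ] n ≡ 2 ^ α * 5 ^ β) × Congruence n → Target n
  only-if ((zero  , zero  , refl) , _)   = inj₁ refl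
  only-if ((suc a , zero  , refl) , hyp) = powers-of-2 a hyp
  only-if ((zero  , suc b , refl) , hyp) = powers-of-5 b hyp
  only-if ((suc a , suc b , refl) , hyp) = contradiction hyp (no-mixed-powers a b)
  if : Target n → (∃[ α ] ∃[ β ] n ≡ 2 ^ α * 5 ^ β) × Congruence n
  -- The quotients of |n φ(n) - 2| by σ(n) in the four cases are 1/1, 0/3, 18/6 and 30/15.
  if (inj₁ refl)                      = (0 , 0 , refl) , divides 1 refl
  if (inj₂ (inj₁ refl))               = (1 , 0 , refl) , divides 0 refl
  if (inj₂ (inj₂ (inj₁ refl)))        = (0 , 1 , refl) , divides 3 refl
  if (inj₂ (inj₂ (inj₂ refl)))        = (3 , 0 , refl) , divides 2 refl
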